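{- Let $R$ be a principal ideal domain and let $I=gR\subsetneq R$ be a proper, non-prime ideal such that $Q:=R/I$ is finite. Write $g=u\cdot\prod_{i=1}^n p_i^{m_i}$ with $u$ a unit, $p_1,\dots,p_n$ pairwise non-associated prime elements and integers $m_1,\dots,m_n\ge 1$, and let $\bm{m}=(m_1,\dots,m_n)$. If $n\ge 3$, then the graph $\Gamma_{E'}(Q)$ is isomorphic to the integral covering graph $D(\bm{m})$.
   Context: Rings are commutative and non-zero with $1$. For a ring $Q$, $Z(Q)$ is the set of $r\in Q$ for which there is $s\in Q\setminus\{0\}$ with $rs=0$. The zero divisor graph $\Gamma(Q)$ has vertex set $Z(Q)\setminus\{0\}$; two distinct vertices $r,s$ are adjacent iff $rs=0$. For a graph $G=(V,E)$ with neighbourhoods $N(\cdot)$, define $u\sim' v$ if $N(u)\setminus\{u,v\}=N(v)\setminus\{u,v\}$; this is an equivalence relation, with classes $[v]'$. The graph $G_{E'}$ has vertex set $\{[v]'\colon v\in V\}$ and edge set $\{\{[u]',[v]'\}\colon [u]'\ne[v]' \text{ and } \{u,v\}\in E\}$. $\Gamma_{E'}(Q)$ denotes $G_{E'}$ for $G=\Gamma(Q)$. For $\bm{m}\in\mathbb{Z}_{\ge 1}^n$, the integral covering graph $D(\bm{m})$ has vertex set $\prod_{i=1}^n \{0,1,\dots,m_i\}\setminus\{\bm{0},\bm{m}\}$, and two distinct vertices $\bm v,\bm w$ are adjacent iff $v_i+w_i\ge m_i$ for all $i\in\{1,\dots,n\}$. -}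

module Defs where

open import Algebra.Bundles using (CommutativeRing; Semiring)
import Algebra.Definitions.RawMagma as RawMagmaDefinitions
import Algebra.Definitions.RawSemiring as RawSemiringDefinitions
import Algebra.Properties.AbelianGroup as AbelianGroupProperties
import Algebra.Properties.CommutativeSemigroup as CommutativeSemigroupProperties
import Algebra.Properties.Ring as RingProperties
import Algebra.Properties.Semiring.Divisibility as SemiringDivisibility
open import Data.Fin.Base using (Fin; toℕ)
open import Data.Nat.Base using (ℕ; suc; _+_; _≤_)
open import Data.Nat.Properties using (+-comm; ≤-trans; ≤-reflexive)
open import Data.Product.Base using (Σ-syntax; ∃-syntax; _×_; _,_; proj₁)
open import Data.Sum.Base using (_⊎_)
open import Data.Vec.Functional using (Vector)
open import Function.Base using (_∘_)
open import Function.Bundles using (Inverse; _⇔_)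
open import Level using (Level; _⊔_)
open import Relation.Binary.Bundles using (Setoid)
open import Relation.Binary.Core using (Rel)
open import Relation.Binary.Definitions using (Symmetric; Irreflexive; _Respects₂_)
import Relation.Binary.Construct.On as On
import Relation.Binary.PropositionalEquality as ≡
open import Relation.Binary.Structures using (IsEquivalence)
open import Relation.Nullary.Negation.Core using (¬_)
open import Relation.Unary using (Pred; _∈_; _∉_; _∖_; _≐_)
open import Relation.Unary.Properties using (≐-refl; ≐-sym; ≐-trans)
open ≡ using (_≡_)

private
  variable
    c ℓ i v e v′ ℓ′ e′ : Level

module Arithmetic (R : CommutativeRing c ℓ) where
  open CommutativeRing R using (Carrier; 1#; semiring; *-rawMagma)
  open RawMagmaDefinitions *-rawMagma using (_∣_; _∥_)
  open RawSemiringDefinitions (Semiring.rawSemiring semiring) public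
    using (Prime; product; _^_)

  Unit : Pred Carrier (c ⊔ ℓ)
  Unit u = u ∣ 1#

  -- Mutual divisibility; in an integral domain this is the same as
  -- differing by a unit factor.
  Associated : Rel Carrier (c ⊔ ℓ)
  Associated = _∥_

module _ (R : CommutativeRing c ℓ) where
  open CommutativeRing R using (Carrier; _≈_; _*_; 0#; 1#) renaming (_+_ to _⊕_)

  record IsIntegralDomain : Set (c ⊔ ℓ) where
    field
      1≉0            : ¬ 1# ≈ 0#
      noZeroDivisors : ∀ {x y} → x * y ≈ 0# → x ≈ 0# ⊎ y ≈ 0#

  record Ideal (i : Level) : Set (c ⊔ ℓ ⊔ Level.suc i) where
    field
      Member   : Pred Carrier i
      resp     : ∀ {x y} → x ≈ y → x ∈ Member → y ∈ Member
      0∈       : 0# ∈ Member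
      +-closed : ∀ {x y} → x ∈ Member → y ∈ Member → x ⊕ y ∈ Member
      *-closed : ∀ r {x} → x ∈ Member → r * x ∈ Member

module _ {R : CommutativeRing c ℓ} (I : Ideal R i) where
  open CommutativeRing R using (Carrier; _*_; 1#)
  open Ideal I

  IsProper : Set i
  IsProper = 1# ∉ Member

  IsPrimeIdeal : Set (c ⊔ i)
  IsPrimeIdeal = IsProper × (∀ {x y} → x * y ∈ Member → x ∈ Member ⊎ y ∈ Member)

module _ (R : CommutativeRing c ℓ) where
  open CommutativeRing R renaming (_+_ to _⊕_)
  open SemiringDivisibility semiring using (_∣_; _∣0; ∣-respʳ; x∣ʳy⇒x∣ʳzy; _,_)

  principalIdeal : Carrier → Ideal R (c ⊔ ℓ)
  principalIdeal g = record
    { Member   = g ∣_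
    ; resp     = ∣-respʳ
    ; 0∈       = g ∣0
    ; +-closed = λ { (p , pg≈x) (q , qg≈y) →
        p ⊕ q , trans (distribʳ g p q) (+-cong pg≈x qg≈y) }
    ; *-closed = λ r → x∣ʳy⇒x∣ʳzy r
    }

  -- The field principal is the classical notion: applied to the ideal of
  -- all x such that x ≈ 0# or P holds, it decides P.
  record IsPrincipalIdealDomain : Set (Level.suc (c ⊔ ℓ)) where
    field
      isIntegralDomain : IsIntegralDomain R
      principal        : (J : Ideal R (c ⊔ ℓ)) →
        ∃[ d ] Ideal.Member J ≐ Ideal.Member (principalIdeal d)

-- The quotient has the same carrier as R, with x and y identified when
-- x - y lies in I.
infixl 7 _/_

_/_ : (R : CommutativeRing c ℓ) → Ideal R i → CommutativeRing c i
R / I = record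
  { Carrier           = Carrier
  ; _≈_               = _≈ᴵ_
  ; _+_               = _⊕_
  ; _*_               = _*_
  ; -_                = -_
  ; 0#                = 0#
  ; 1#                = 1#
  ; isCommutativeRing = record
    { isRing = record
      { +-isAbelianGroup = record
        { isGroup = record
          { isMonoid = record
            { isSemigroup = record
              { isMagma = record
                { isEquivalence = record
                  { refl  = reflexive refl
                  ; sym   = symᴵ
                  ; trans = transᴵ
                  }
                ; ∙-cong = +-congᴵ
                }
              ; assoc = λ x y z → reflexive (+-assoc x y z)
              }
            ; identity = reflexive ∘ +-identityˡ , reflexive ∘ +-identityʳ
            }
          ; inverse = reflexive ∘ -‿inverseˡ , reflexive ∘ -‿inverseʳ
          ; ⁻¹-cong = -‿congᴵ
          }
        ; comm = λ x y → reflexive (+-comm′ x y)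
        }
      ; *-cong     = *-congᴵ
      ; *-assoc    = λ x y z → reflexive (*-assoc x y z)
      ; *-identity = reflexive ∘ *-identityˡ , reflexive ∘ *-identityʳ
      ; distrib    = (λ x y z → reflexive (distribˡ x y z))
                   , (λ x y z → reflexive (distribʳ x y z))
      }
    ; *-comm = λ x y → reflexive (*-comm x y)
    }
  }
  where
  open CommutativeRing R hiding (reflexive) renaming (_+_ to _⊕_; +-comm to +-comm′)
  open AbelianGroupProperties +-abelianGroup
    using (x≈y⇒x∙y⁻¹≈ε; ⁻¹-anti-homo‿-; ⁻¹-∙-comm; //-rightDividesˡ)
  open CommutativeSemigroupProperties +-commutativeSemigroup using (interchange)
  open RingProperties ring using (-1*x≈-x; x[y-z]≈xy-xz)
  open Ideal I

  infix 4 _≈ᴵ_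
  _≈ᴵ_ : Rel Carrier _
  x ≈ᴵ y = x - y ∈ Member

  reflexive : ∀ {x y} → x ≈ y → x ≈ᴵ y
  reflexive x≈y = resp (sym (x≈y⇒x∙y⁻¹≈ε x≈y)) 0∈

  neg-closed : ∀ {x} → x ∈ Member → - x ∈ Member
  neg-closed {x} x∈ = resp (-1*x≈-x x) (*-closed (- 1#) x∈)

  symᴵ : ∀ {x y} → x ≈ᴵ y → y ≈ᴵ x
  symᴵ {x} {y} x≈y = resp (⁻¹-anti-homo‿- x y) (neg-closed x≈y)

  transᴵ : ∀ {x y z} → x ≈ᴵ y → y ≈ᴵ z → x ≈ᴵ z
  transᴵ {x} {y} {z} x≈y y≈z = resp
    (trans (sym (+-assoc (x - y) y (- z))) (+-congʳ (//-rightDividesˡ y x)))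
    (+-closed x≈y y≈z)

  +-congᴵ : ∀ {x y z w} → x ≈ᴵ y → z ≈ᴵ w → x ⊕ z ≈ᴵ y ⊕ w
  +-congᴵ {x} {y} {z} {w} x≈y z≈w = resp
    (trans (interchange x (- y) z (- w)) (+-congˡ (⁻¹-∙-comm y w)))
    (+-closed x≈y z≈w)

  -‿congᴵ : ∀ {x y} → x ≈ᴵ y → - x ≈ᴵ - y
  -‿congᴵ {x} {y} x≈y = resp (sym (⁻¹-∙-comm x (- y))) (neg-closed x≈y)

  *-congˡᴵ : ∀ r {x y} → x ≈ᴵ y → r * x ≈ᴵ r * y
  *-congˡᴵ r {x} {y} x≈y = resp (x[y-z]≈xy-xz r x y) (*-closed r x≈y)

  *-congᴵ : ∀ {x y z w} → x ≈ᴵ y → z ≈ᴵ w → x * z ≈ᴵ y * w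
  *-congᴵ {x} {y} {z} {w} x≈y z≈w =
    transᴵ (reflexive (*-comm x z))
    (transᴵ (*-congˡᴵ z x≈y)
    (transᴵ (reflexive (*-comm z y)) (*-congˡᴵ y z≈w)))

Finite : Setoid c ℓ → Set (c ⊔ ℓ)
Finite S = ∃[ k ] Inverse (≡.setoid (Fin k)) S

record Graph (v ℓ e : Level) : Set (Level.suc (v ⊔ ℓ ⊔ e)) where
  field
    vertices : Setoid v ℓ

  open Setoid vertices public renaming (Carrier to Vertex)

  field
    Adj         : Rel Vertex e
    Adj-resp-≈  : Adj Respects₂ _≈_
    Adj-sym     : Symmetric Adj
    Adj-irrefl  : Irreflexive _≈_ Adj

infix 4 _≅_

record _≅_ (G : Graph v ℓ e) (H : Graph v′ ℓ′ e′) : Set (v ⊔ ℓ ⊔ e ⊔ v′ ⊔ ℓ′ ⊔ e′) where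
  private
    module G = Graph G
    module H = Graph H
  field
    bijection : Inverse G.vertices H.vertices
  open Inverse bijection using (to)
  field
    adjacency : ∀ x y → G.Adj x y ⇔ H.Adj (to x) (to y)

module _ (G : Graph v ℓ e) where
  open Graph G

  N : Vertex → Pred Vertex e
  N x = λ y → Adj x y

  ⁅_,_⁆ : Vertex → Vertex → Pred Vertex ℓ
  ⁅ x , y ⁆ = λ z → z ≈ x ⊎ z ≈ y

  infix 4 _∼′_
  _∼′_ : Rel Vertex (v ⊔ ℓ ⊔ e)
  x ∼′ y = (N x ∖ ⁅ x , y ⁆) ≐ (N y ∖ ⁅ x , y ⁆)

  [_]′ : Vertex → Pred Vertex (v ⊔ ℓ ⊔ e)
  [ x ]′ = λ y → x ∼′ y

  -- A vertex x stands for the class [ x ]′, and vertices are compared as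
  -- classes, by extensional equality.  This agrees with _∼′_ whenever
  -- _∼′_ is an equivalence relation, but is one without having to assume
  -- that equality of vertices of G is decidable, which transitivity of
  -- _∼′_ needs.
  _E′ : Graph v (v ⊔ ℓ ⊔ e) (v ⊔ ℓ ⊔ e)
  _E′ = record
    { vertices   = record
      { Carrier       = Vertex
      ; _≈_           = _≈′_
      ; isEquivalence = isEquivalence′
      }
    ; Adj        = Adj′
    ; Adj-resp-≈ =
        (λ { y≈z (a , b , a≈x , b≈y , x≉y , ab) →
             a , b , a≈x , E.trans b≈y y≈z , (λ x≈z → x≉y (E.trans x≈z (E.sym y≈z))) , ab })
      , (λ { x≈z (a , b , a≈x , b≈y , x≉y , ab) →
             a , b , E.trans a≈x x≈z , b≈y , (λ z≈y → x≉y (E.trans x≈z z≈y)) , ab })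
    ; Adj-sym    = λ { (a , b , a≈x , b≈y , x≉y , ab) →
             b , a , b≈y , a≈x , (λ y≈x → x≉y (E.sym y≈x)) , Adj-sym ab }
    ; Adj-irrefl = λ { x≈y (_ , _ , _ , _ , x≉y , _) → x≉y x≈y }
    }
    where
    infix 4 _≈′_
    _≈′_ : Rel Vertex (v ⊔ ℓ ⊔ e)
    x ≈′ y = [ x ]′ ≐ [ y ]′

    isEquivalence′ : IsEquivalence _≈′_
    isEquivalence′ = record { refl = ≐-refl ; sym = ≐-sym ; trans = ≐-trans }

    module E = IsEquivalence isEquivalence′

    Adj′ : Rel Vertex (v ⊔ ℓ ⊔ e)
    Adj′ x y = ∃[ a ] ∃[ b ] a ≈′ x × b ≈′ y × ¬ x ≈′ y × Adj a b

module _ (Q : CommutativeRing c ℓ) where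
  open CommutativeRing Q

  Z : Pred Carrier (c ⊔ ℓ)
  Z r = ∃[ s ] s ≉ 0# × r * s ≈ 0#

  Γ : Graph (c ⊔ ℓ) ℓ ℓ
  Γ = record
    { vertices   = On.setoid {B = ∃[ r ] r ∈ Z × r ≉ 0#} setoid proj₁
    ; Adj        = λ { (r , _) (s , _) → r ≉ s × r * s ≈ 0# }
    ; Adj-resp-≈ =
        (λ { y≈z (x≉y , xy≈0) →
             (λ x≈z → x≉y (trans x≈z (sym y≈z))) , trans (*-congˡ (sym y≈z)) xy≈0 })
      , (λ { x≈z (x≉y , xy≈0) →
             (λ z≈y → x≉y (trans x≈z z≈y)) , trans (*-congʳ (sym x≈z)) xy≈0 })
    ; Adj-sym    = λ { (x≉y , xy≈0) → (λ y≈x → x≉y (sym y≈x)) , trans (*-comm _ _) xy≈0 }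
    ; Adj-irrefl = λ { x≈y (x≉y , _) → x≉y x≈y }
    }

  ΓE′ : Graph (c ⊔ ℓ) (c ⊔ ℓ) (c ⊔ ℓ)
  ΓE′ = Γ E′

module _ {n : ℕ} (m : Vector ℕ n) where

  Box : Set
  Box = (k : Fin n) → Fin (suc (m k))

  D : Graph _ _ _
  D = record
    { vertices   = record
      { Carrier       = Σ[ x ∈ Box ] ¬ (∀ k → toℕ (x k) ≡ 0) × ¬ (∀ k → toℕ (x k) ≡ m k)
      ; _≈_           = λ { (x , _) (y , _) → ∀ k → x k ≡ y k }
      ; isEquivalence = record
        { refl  = λ _ → ≡.refl
        ; sym   = λ x≈y k → ≡.sym (x≈y k)
        ; trans = λ x≈y y≈z k → ≡.trans (x≈y k) (y≈z k)
        }
      }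
    ; Adj        = λ { (x , _) (y , _) →
        ¬ (∀ k → x k ≡ y k) × (∀ k → m k ≤ toℕ (x k) + toℕ (y k)) }
    ; Adj-resp-≈ =
        (λ { y≈z (x≉y , m≤) →
             (λ x≈z → x≉y (λ k → ≡.trans (x≈z k) (≡.sym (y≈z k))))
             , (λ k → ≡.subst (λ t → _ ≤ _ + toℕ t) (y≈z k) (m≤ k)) })
      , (λ { x≈z (x≉y , m≤) →
             (λ z≈y → x≉y (λ k → ≡.trans (x≈z k) (z≈y k)))
             , (λ k → ≡.subst (λ t → _ ≤ toℕ t + _) (x≈z k) (m≤ k)) })
    ; Adj-sym    = λ { {x , _} {y , _} (x≉y , m≤) →
        (λ y≈x → x≉y (λ k → ≡.sym (y≈x k)))
        , (λ k → ≤-trans (m≤ k) (≤-reflexive (+-comm (toℕ (x k)) (toℕ (y k))))) }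
    ; Adj-irrefl = λ { x≈y (x≉y , _) → x≉y x≈y }
    }

{-# OPTIONS --safe #-}

-- Let v r ∈ ∏ᵢ {0,…,mᵢ} record, for every i, the exponent of pᵢ in r, cut off
-- at mᵢ.  Divisibility by prime powers shows that v is surjective and that
-- r * s ≈ 0 in Q  iff  v r + v s ≥ m.  The whole graph is thus read off from v,
-- and it remains to see that r ∼′ s forces v r ≡ v s: for box points x and y with
-- yᵢ < xᵢ, some third point w, different from both, has sum at least m with
-- exactly one of them.  The first choice is wᵢ = mᵢ - xᵢ and wⱼ = mⱼ for j ≠ i; if
-- it is x or y, two further coordinates leave enough room to change it.
module Submission where

open import Defs hiding ([_]′)
open import Algebra.Bundles using (CommutativeRing)
import Algebra.Properties.CommutativeMonoid.Sum as CommutativeMonoidSum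
import Algebra.Properties.CommutativeSemigroup as CommutativeSemigroupProperties
import Algebra.Properties.CommutativeSemigroup.Divisibility as CommutativeSemigroupDivisibility
import Algebra.Properties.Group as GroupProperties
import Algebra.Properties.Ring as RingProperties
import Algebra.Properties.Semiring.Divisibility as SemiringDivisibility
import Algebra.Properties.Semiring.Exp as SemiringExp
open import Data.Fin.Base using (Fin; zero; suc; toℕ; fromℕ; opposite; punchIn)
import Data.Fin.Properties as Fin
open import Data.List.Base using (List; []; _∷_; [_])
open import Data.List.Membership.Propositional using (_∈_; _∉_)
open import Data.List.Relation.Unary.Any using (here; there)
open import Data.Nat.Base as ℕ using (ℕ; zero; suc; _≤_; _<_; z≤n; s≤s; s≤s⁻¹)
import Data.Nat.Properties as ℕ
open import Data.Product.Base using (∃-syntax; _×_; _,_; proj₁; proj₂)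
open import Data.Sum.Base using (_⊎_; inj₁; inj₂; [_,_]′; swap)
open import Data.Vec.Functional using (Vector)
open import Function.Base using (_∘_; id)
open import Function.Bundles using (_⇔_; mk⇔; Equivalence)
open import Level using (Level; _⊔_)
open import Relation.Binary.Definitions using (tri<; tri≈; tri>)
open import Relation.Binary.PropositionalEquality as ≡ using (_≡_; _≢_)
import Relation.Binary.Reasoning.Setoid as ≈-Reasoning
open import Relation.Nullary.Decidable.Core using (Dec; yes; no; decidable-stable)
open import Relation.Nullary.Negation.Core using (¬_; contradiction)
open import Relation.Unary using (_≐_)

private
  variable
    c ℓ : Level

-- Separating points of the box by coverings.

two-others : ∀ {n} → 3 ≤ n → (i : Fin n) → ∃[ j ] ∃[ k ] j ≢ i × k ≢ i × j ≢ k
two-others {suc (suc (suc n))} (s≤s (s≤s (s≤s z≤n))) i =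
  punchIn i zero , punchIn i (suc zero) , Fin.punchInᵢ≢i i _ , Fin.punchInᵢ≢i i _
  , λ eq → contradiction (Fin.punchIn-injective i _ _ eq) λ ()

≢⇒∉[] : ∀ {a} {A : Set a} {x y : A} → x ≢ y → x ∉ [ y ]
≢⇒∉[] x≢y (here x≡y) = x≢y x≡y

opposite-+ : ∀ {m} (x : Fin (suc m)) → toℕ (opposite x) ℕ.+ toℕ x ≡ m
opposite-+ x = ≡.trans
  (≡.cong (ℕ._+ toℕ x) (Fin.opposite-prop x)) (ℕ.m∸n+n≡m (Fin.toℕ≤pred[n] x))

module BoxPoints {n : ℕ} (m : Vector ℕ n) where

  open import Data.List.Membership.DecPropositional (Fin._≟_ {n}) using (_∈?_)

  Covers : Box m → Box m → Set
  Covers x y = ∀ k → m k ≤ toℕ (x k) ℕ.+ toℕ (y k)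

  infix 4 _≋_ _≋?_

  _≋_ : Box m → Box m → Set
  x ≋ y = ∀ k → x k ≡ y k

  _≋?_ : ∀ x y → Dec (x ≋ y)
  x ≋? y = Fin.all? λ k → x k Fin.≟ y k

  entry≤ : ∀ (x : Box m) k → toℕ (x k) ≤ m k
  entry≤ x k = Fin.toℕ≤pred[n] (x k)

  covers-resp : ∀ {x x′ y y′} → x ≋ x′ → y ≋ y′ → Covers x y → Covers x′ y′
  covers-resp x≋ y≋ x+y≥m k =
    ≡.subst₂ (λ s t → m k ≤ toℕ s ℕ.+ toℕ t) (x≋ k) (y≋ k) (x+y≥m k)

  covers-sym : ∀ {x y} → Covers x y → Covers y x
  covers-sym {x} {y} x+y≥m k = ℕ.≤-trans (x+y≥m k) (ℕ.≤-reflexive (ℕ.+-comm (toℕ (x k)) _))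

  -- On `S` this is the least entry that covers `x`, so it fails there against anything smaller; off
  -- `S` the maximal entry covers everything.
  complementOn : List (Fin n) → Box m → Box m
  complementOn S x k with k ∈? S
  ... | yes _ = opposite (x k)
  ... | no  _ = fromℕ (m k)

  complementOn-∈ : ∀ {S k} x → k ∈ S → toℕ (complementOn S x k) ≡ m k ℕ.∸ toℕ (x k)
  complementOn-∈ {S} {k} x k∈S with k ∈? S
  ... | yes _   = Fin.opposite-prop (x k)
  ... | no  k∉S = contradiction k∈S k∉S

  complementOn-∉ : ∀ {S k} x → k ∉ S → toℕ (complementOn S x k) ≡ m k
  complementOn-∉ {S} {k} x k∉S with k ∈? S
  ... | yes k∈S = contradiction k∈S k∉S
  ... | no  _   = Fin.toℕ-fromℕ (m k)

  complementOn-covers : ∀ S x → Covers (complementOn S x) x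
  complementOn-covers S x k with k ∈? S
  ... | yes _ = ℕ.≤-reflexive (≡.sym (opposite-+ (x k)))
  ... | no  _ = ℕ.≤-trans (ℕ.≤-reflexive (≡.sym (Fin.toℕ-fromℕ (m k)))) (ℕ.m≤m+n _ _)

  complementOn-¬covers : ∀ {S i} x y → i ∈ S → toℕ (y i) < toℕ (x i) →
                         ¬ Covers (complementOn S x) y
  complementOn-¬covers {S} {i} x y i∈S y<x w+y≥m = ℕ.<-irrefl ≡.refl (begin-strict
    m i                                    ≤⟨ w+y≥m i ⟩
    toℕ (complementOn S x i) ℕ.+ toℕ (y i) <⟨ ℕ.+-monoʳ-< _ y<x ⟩
    toℕ (complementOn S x i) ℕ.+ toℕ (x i) ≡⟨ ≡.cong (ℕ._+ _) (complementOn-∈ x i∈S) ⟩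
    m i ℕ.∸ toℕ (x i) ℕ.+ toℕ (x i)        ≡⟨ ℕ.m∸n+n≡m (entry≤ x i) ⟩
    m i                                    ∎)
    where open ℕ.≤-Reasoning

  complement : Box m → Box m
  complement x = opposite ∘ x

  complement-covers : ∀ x → Covers (complement x) x
  complement-covers x k = ℕ.≤-reflexive (≡.sym (opposite-+ (x k)))

  complement-covers⇒≤ : ∀ x y → Covers (complement x) y → ∀ k → toℕ (x k) ≤ toℕ (y k)
  complement-covers⇒≤ x y x̄+y≥m k = ℕ.+-cancelˡ-≤ (toℕ (opposite (x k))) _ _
    (ℕ.≤-trans (ℕ.≤-reflexive (opposite-+ (x k))) (x̄+y≥m k))

  -- The two inequalities are there because `_∼′_` removes the compared vertices from the
  -- neighbourhoods, so neither can serve as witness.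
  record Separates (x y w : Box m) : Set where
    field
      covers  : Covers w x
      ¬covers : ¬ Covers w y
      ≉ˡ      : ¬ w ≋ x
      ≉ʳ      : ¬ w ≋ y

  Separable : Box m → Box m → Set
  Separable x y = (∃[ w ] Separates x y w) ⊎ (∃[ w ] Separates y x w)

  module _ (m≥1 : ∀ k → 1 ≤ m k) (n≥3 : 3 ≤ n) where

    <⇒separable : ∀ {x y i} → toℕ (y i) < toℕ (x i) → Separable x y
    <⇒separable {x} {y} {i} y<x
      with j , k , j≢i , k≢i , j≢k ← two-others n≥3 i = go
      where
      separates : ∀ {S} → i ∈ S → ¬ complementOn S x ≋ x → ¬ complementOn S x ≋ y → Separable x y
      separates {S} i∈S ≉x ≉y = inj₁ (complementOn S x , record
        { covers  = complementOn-covers S x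
        ; ¬covers = complementOn-¬covers x y i∈S y<x
        ; ≉ˡ      = ≉x
        ; ≉ʳ      = ≉y
        })

      below : ∀ {S l} → l ∈ S → 0 < toℕ (x l) → toℕ (complementOn S x l) ≢ m l
      below {S} {l} l∈S x>0 eq = ℕ.<⇒≢ (ℕ.∸-monoʳ-< x>0 (entry≤ x l))
        (≡.trans (≡.sym (complementOn-∈ x l∈S)) eq)

      full : ∀ {w l} → complementOn [ i ] x ≋ w → l ≢ i → toℕ (w l) ≡ m l
      full eq l≢i = ≡.trans (≡.cong toℕ (≡.sym (eq _))) (complementOn-∉ x (≢⇒∉[] l≢i))

      full>0 : ∀ {w l} → complementOn [ i ] x ≋ w → l ≢ i → 0 < toℕ (w l)
      full>0 eq l≢i = ≡.subst (0 <_) (≡.sym (full eq l≢i)) (m≥1 _)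

      changed : ∀ {w l} → complementOn [ i ] x ≋ w → l ≢ i → 0 < toℕ (x l) →
                ¬ complementOn (i ∷ l ∷ []) x ≋ w
      changed eq l≢i x>0 eq′ =
        below (there (here ≡.refl)) x>0 (≡.trans (≡.cong toℕ (eq′ _)) (full eq l≢i))

      -- Here `x` is full off `i`, so complementing at `j` as well lowers that entry from `m j` to 0
      -- and moves away from `x`. If this hits `y`, complementing at `k` instead leaves entry `j` at
      -- `m j`, where `y` has 0.
      when-x : complementOn [ i ] x ≋ x → Separable x y
      when-x eq with complementOn (i ∷ j ∷ []) x ≋? y
      ... | no  ≉y  = separates (here ≡.refl) (changed eq j≢i (full>0 eq j≢i)) ≉y
      ... | yes eq′ = separates (here ≡.refl) (changed eq k≢i (full>0 eq k≢i)) λ eq″ →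
        below (there (here ≡.refl)) (full>0 eq j≢i)
          (≡.trans (≡.cong toℕ (≡.trans (eq′ j) (≡.sym (eq″ j))))
                   (complementOn-∉ {i ∷ k ∷ []} x
                     λ { (here j≡i) → j≢i j≡i ; (there (here j≡k)) → j≢k j≡k }))

      -- Entry `i` of the new point is still that of `y`, hence below that of `x`; entry `l` drops
      -- below `m l`, which is its value in `y`.
      when-y-pos : complementOn [ i ] x ≋ y → ∀ {l} → l ≢ i → 0 < toℕ (x l) → Separable x y
      when-y-pos eq {l} l≢i x>0 = separates {i ∷ l ∷ []} (here ≡.refl)
        (λ eq′ → ℕ.<⇒≢ y<x
          (≡.trans (≡.cong toℕ (≡.sym (eq i)))
          (≡.trans (complementOn-∈ x (here ≡.refl))
          (≡.trans (≡.sym (complementOn-∈ {i ∷ l ∷ []} x (here ≡.refl))) (≡.cong toℕ (eq′ i))))))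
        (changed eq l≢i x>0)

      -- As `y` is full off `i` while `x` vanishes at `j` and `k`, the roles are exchanged:
      -- complementing `y` at `j` gives 0 there, unlike `y`, and `m k` at `k`, unlike `x`.
      when-y-zero : complementOn [ i ] x ≋ y → toℕ (x j) ≡ 0 → toℕ (x k) ≡ 0 → Separable x y
      when-y-zero eq xj≡0 xk≡0 = inj₂ (complementOn [ j ] y , record
        { covers  = complementOn-covers [ j ] y
        ; ¬covers = complementOn-¬covers y x (here ≡.refl) xj<yj
        ; ≉ˡ      = λ eq′ → ℕ.<⇒≢ (m≥1 j)
            (≡.trans (≡.sym (ℕ.n∸n≡0 (m j)))
            (≡.trans (≡.cong (m j ℕ.∸_) (≡.sym (full eq j≢i)))
            (≡.trans (≡.sym (complementOn-∈ y (here ≡.refl)))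
            (≡.trans (≡.cong toℕ (eq′ j)) (full eq j≢i)))))
        ; ≉ʳ      = λ eq′ → ℕ.<⇒≢ (m≥1 k)
            (≡.trans (≡.sym xk≡0)
            (≡.trans (≡.cong toℕ (≡.sym (eq′ k)))
            (complementOn-∉ y (≢⇒∉[] (j≢k ∘ ≡.sym)))))
        })
        where
        xj<yj : toℕ (x j) < toℕ (y j)
        xj<yj = ≡.subst (_< _) (≡.sym xj≡0) (full>0 eq j≢i)

      go : Separable x y
      go with complementOn [ i ] x ≋? x | complementOn [ i ] x ≋? y
      ... | yes eq | _      = when-x eq
      ... | no ≉x  | no ≉y  = separates (here ≡.refl) ≉x ≉y
      ... | no _   | yes eq with toℕ (x j) ℕ.≟ 0 | toℕ (x k) ℕ.≟ 0
      ... | no x≢0 | _      = when-y-pos eq j≢i (ℕ.n≢0⇒n>0 x≢0)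
      ... | yes _  | no x≢0 = when-y-pos eq k≢i (ℕ.n≢0⇒n>0 x≢0)
      ... | yes x≡0 | yes x′≡0 = when-y-zero eq x≡0 x′≡0

    ≉⇒separable : ∀ {x y} → ¬ x ≋ y → Separable x y
    ≉⇒separable {x} {y} x≉y
      with i , xi≢yi ← Fin.¬∀⟶∃¬ n _ (λ k → x k Fin.≟ y k) x≉y
      with Fin.<-cmp (x i) (y i)
    ... | tri< x<y _ _ = swap (<⇒separable x<y)
    ... | tri≈ _ x≡y _ = contradiction x≡y xi≢yi
    ... | tri> _ _ y<x = <⇒separable y<x

-- From a map into the box to the graph isomorphism.

module ZeroDivisorGraph
  (Q : CommutativeRing c ℓ) {n : ℕ} {m : Vector ℕ n} (m≥1 : ∀ k → 1 ≤ m k) (n≥3 : 3 ≤ n)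
  (v : CommutativeRing.Carrier Q → Box m)
  (v-surjective : ∀ w → ∃[ x ] BoxPoints._≋_ m (v x) w)
  (zero-product : ∀ x y → CommutativeRing._≈_ Q (CommutativeRing._*_ Q x y) (CommutativeRing.0# Q)
                            ⇔ BoxPoints.Covers m (v x) (v y))
  where

  open CommutativeRing Q hiding (zero)
  open BoxPoints m

  private
    module G = Graph (Γ Q)
    module H = Graph (ΓE′ Q)
    module D = Graph (D m)

  zero⇒covers : ∀ {x y} → x * y ≈ 0# → Covers (v x) (v y)
  zero⇒covers = Equivalence.to (zero-product _ _)

  covers⇒zero : ∀ {x y} → Covers (v x) (v y) → x * y ≈ 0#
  covers⇒zero = Equivalence.from (zero-product _ _)

  -- Some `t` has vector `complement (v x)` and annihilates `x`, hence also `y`; as the complement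
  -- and `v x` add up to exactly `m`, this forces `v y` to be at least `v x`.
  v-mono : ∀ {x y} → x ≈ y → ∀ k → toℕ (v x k) ≤ toℕ (v y k)
  v-mono {x} {y} x≈y with t , vt ← v-surjective (complement (v x)) =
    complement-covers⇒≤ (v x) (v y) (covers-resp vt (λ _ → ≡.refl) (zero⇒covers
      (trans (*-congˡ (sym x≈y)) (covers⇒zero
        (covers-resp (≡.sym ∘ vt) (λ _ → ≡.refl) (complement-covers (v x)))))))

  v-cong : ∀ {x y} → x ≈ y → v x ≋ v y
  v-cong x≈y k = Fin.toℕ-injective (ℕ.≤-antisym (v-mono x≈y k) (v-mono (sym x≈y) k))

  max⇒zero : ∀ {x} → (∀ k → toℕ (v x k) ≡ m k) → x ≈ 0#
  max⇒zero {x} max = trans (sym (*-identityʳ x)) (covers⇒zero λ k →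
    ℕ.≤-trans (ℕ.≤-reflexive (≡.sym (max k))) (ℕ.m≤m+n _ _))

  zero⇒max : ∀ {x} → x ≈ 0# → ∀ k → toℕ (v x k) ≡ m k
  -- An element `t` with zero vector is annihilated by `x`, so `v x` alone must reach `m`.
  zero⇒max {x} x≈0 k with t , vt ← v-surjective (λ _ → zero) = ℕ.≤-antisym (entry≤ (v x) k) (begin
    m k                        ≤⟨ zero⇒covers (trans (*-congʳ x≈0) (zeroˡ t)) k ⟩
    toℕ (v x k) ℕ.+ toℕ (v t k) ≡⟨ ≡.cong (λ s → toℕ (v x k) ℕ.+ toℕ s) (vt k) ⟩
    toℕ (v x k) ℕ.+ 0          ≡⟨ ℕ.+-identityʳ _ ⟩
    toℕ (v x k)                ∎)
    where open ℕ.≤-Reasoning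

  min⇒¬zeroDivisor : ∀ {x} → (∀ k → toℕ (v x k) ≡ 0) → ¬ Z Q x
  min⇒¬zeroDivisor min (s , s≉0 , xs≈0) = s≉0 (max⇒zero λ k →
    ℕ.≤-antisym (entry≤ (v s) k) (≡.subst (λ t → _ ≤ t ℕ.+ _) (min k) (zero⇒covers xs≈0 k)))

  ¬min⇒zeroDivisor : ∀ {x} → ¬ (∀ k → toℕ (v x k) ≡ 0) → Z Q x
  ¬min⇒zeroDivisor {x} ¬min with t , vt ← v-surjective (complement (v x)) =
    -- The witness has the vector complementary to `v x`. Were it zero, that vector would be `m`,
    -- which leaves nothing for `v x`.
    t
    , (λ t≈0 → ¬min λ k → ℕ.+-cancelˡ-≡ (m k) _ _ (≡.trans
        (≡.cong (ℕ._+ toℕ (v x k)) (≡.trans (≡.sym (zero⇒max t≈0 k)) (≡.cong toℕ (vt k))))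
        (≡.trans (opposite-+ (v x k)) (≡.sym (ℕ.+-identityʳ (m k))))))
    , covers⇒zero (covers-sym {v t} {v x}
        (covers-resp (≡.sym ∘ vt) (λ _ → ≡.refl) (complement-covers (v x))))

  -- An element of vector `w` is indeed a vertex: it annihilates the nonzero `r`, and it is nonzero
  -- because its product with `s` is.
  separating-vertex : ∀ {x y w} → Separates (v (proj₁ x)) (v (proj₁ y)) w →
                      ∃[ z ] G.Adj x z × ¬ G.Adj y z × ¬ z G.≈ x × ¬ z G.≈ y
  separating-vertex {r , _ , r≉0} {s , _} {w} sep with t , vt ← v-surjective w =
      (t , (r , r≉0 , tr≈0) , λ t≈0 → ts≉0 (trans (*-congʳ t≈0) (zeroˡ s)))
    , ((λ r≈t → t≉r (sym r≈t)) , trans (*-comm r t) tr≈0)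
    , (λ (_ , st≈0) → ts≉0 (trans (*-comm t s) st≈0))
    , t≉r
    , (λ t≈s → ≉ʳ λ k → ≡.trans (≡.sym (vt k)) (v-cong t≈s k))
    where
    open Separates sep
    tr≈0 : t * r ≈ 0#
    tr≈0 = covers⇒zero (covers-resp (≡.sym ∘ vt) (λ _ → ≡.refl) covers)
    ts≉0 : t * s ≉ 0#
    ts≉0 ts≈0 = ¬covers (covers-resp vt (λ _ → ≡.refl) (zero⇒covers ts≈0))
    t≉r : t ≉ r
    t≉r t≈r = ≉ˡ λ k → ≡.trans (≡.sym (vt k)) (v-cong t≈r k)

  ∼′⇒≋ : ∀ {x y} → _∼′_ (Γ Q) x y → v (proj₁ x) ≋ v (proj₁ y)
  -- Equality of box points is decidable, which permits an argument by contradiction.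
  ∼′⇒≋ {x} {y} (Nx⊆Ny , Ny⊆Nx) = decidable-stable (_ ≋? _) λ x≉y →
    [ (λ (_ , sep) → let z , xz , ¬yz , z≉x , z≉y = separating-vertex {x} {y} sep in
         ¬yz (proj₁ (Nx⊆Ny {z} (xz , [ z≉x , z≉y ]′))))
    , (λ (_ , sep) → let z , yz , ¬xz , z≉y , z≉x = separating-vertex {y} {x} sep in
         ¬xz (proj₁ (Ny⊆Nx {z} (yz , [ z≉x , z≉y ]′))))
    ]′ (≉⇒separable m≥1 n≥3 x≉y)

  -- Vanishing of products depends on `v` only. The distinctness part of adjacency comes from `z`
  -- lying outside the removed pair.
  ≋⇒∼′ : ∀ {x y} → v (proj₁ x) ≋ v (proj₁ y) → _∼′_ (Γ Q) x y
  ≋⇒∼′ x≋y =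
      (λ ((_ , xz≈0) , z∉) →
         ((λ y≈z → z∉ (inj₂ (sym y≈z)))
         , covers⇒zero (covers-resp x≋y (λ _ → ≡.refl) (zero⇒covers xz≈0))) , z∉)
    , (λ ((_ , yz≈0) , z∉) →
         ((λ x≈z → z∉ (inj₁ (sym x≈z)))
         , covers⇒zero (covers-resp (≡.sym ∘ x≋y) (λ _ → ≡.refl) (zero⇒covers yz≈0))) , z∉)

  class-≈⇒≋ : ∀ {x y} → x H.≈ y → v (proj₁ x) ≋ v (proj₁ y)
  -- The vertex `y` lies in its own class, hence in that of `x`.
  class-≈⇒≋ {x} {y} (_ , [y]⊆[x]) = ∼′⇒≋ {x} {y} ([y]⊆[x] {y} (≋⇒∼′ {y} {y} λ _ → ≡.refl))

  ≋⇒class-≈ : ∀ {x y} → v (proj₁ x) ≋ v (proj₁ y) → x H.≈ y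
  ≋⇒class-≈ {x} {y} x≋y =
      (λ {z} x∼z → ≋⇒∼′ {y} {z} λ k → ≡.trans (≡.sym (x≋y k)) (∼′⇒≋ {x} {z} x∼z k))
    , (λ {z} y∼z → ≋⇒∼′ {x} {z} λ k → ≡.trans (x≋y k) (∼′⇒≋ {y} {z} y∼z k))

  toBox : H.Vertex → D.Vertex
  toBox (r , r∈Z , r≉0) = v r , (λ min → min⇒¬zeroDivisor min r∈Z) , λ max → r≉0 (max⇒zero max)

  fromBox : D.Vertex → H.Vertex
  fromBox (w , ¬min , ¬max) with r , vr ← v-surjective w =
      r
    , ¬min⇒zeroDivisor (λ min → ¬min λ k → ≡.trans (≡.cong toℕ (≡.sym (vr k))) (min k))
    , λ r≈0 → ¬max λ k → ≡.trans (≡.cong toℕ (≡.sym (vr k))) (zero⇒max r≈0 k)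

  v-fromBox : ∀ w → v (proj₁ (fromBox w)) ≋ proj₁ w
  v-fromBox (w , _) = proj₂ (v-surjective w)

  ΓE′≅D : ΓE′ Q ≅ D m
  ΓE′≅D = record
    { bijection = record
      { to        = toBox
      ; from      = fromBox
      ; to-cong   = λ {x} {y} → class-≈⇒≋ {x} {y}
      ; from-cong = λ {w} {w′} w≋w′ → ≋⇒class-≈ {fromBox w} {fromBox w′} λ k →
          ≡.trans (v-fromBox w k) (≡.trans (w≋w′ k) (≡.sym (v-fromBox w′ k)))
      ; inverse   =
          (λ {w} {x} x≈w k → ≡.trans (class-≈⇒≋ {x} {fromBox w} x≈w k) (v-fromBox w k))
        , (λ {x} {w} w≋x → ≋⇒class-≈ {fromBox w} {x} λ k → ≡.trans (v-fromBox w k) (w≋x k))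
      }
    ; adjacency = λ x y → mk⇔
        (λ (a , b , a≈x , b≈y , x≉y , _ , ab≈0) →
            (λ x≋y → x≉y (≋⇒class-≈ {x} {y} x≋y))
          , covers-resp (class-≈⇒≋ {a} {x} a≈x) (class-≈⇒≋ {b} {y} b≈y) (zero⇒covers ab≈0))
        (λ (x≉y , x+y≥m) →
            x , y , H.refl {x} , H.refl {y} , (λ x≈y → x≉y (class-≈⇒≋ {x} {y} x≈y))
          , (λ x≈y → x≉y (v-cong x≈y)) , covers⇒zero x+y≥m)
    }

-- Bounded search and decidability.

-- The search goes upwards and stops before the first failure of `P`, or at the cap `m`, where
-- nothing is claimed about the successor.
greatest : ∀ {a} {P : ℕ → Set a} → (∀ k → Dec (P k)) → P 0 → ∀ m →
           ∃[ k ] P (toℕ {suc m} k) × (toℕ k < m → ¬ P (suc (toℕ k)))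
greatest P? p₀ zero = zero , p₀ , λ ()
greatest P? p₀ (suc m) with P? 1
... | no ¬p₁ = zero , p₀ , λ _ → ¬p₁
... | yes p₁ with k , pₖ , ¬pₖ₊₁ ← greatest (P? ∘ suc) p₁ m = suc k , pₖ , ¬pₖ₊₁ ∘ s≤s⁻¹

-- Computing exponents requires deciding divisibility by prime powers, and the ring comes with no
-- procedure for it; the generator of a suitable ideal provides one.
excluded-middle : {R : CommutativeRing c ℓ} → IsPrincipalIdealDomain R → (P : Set (c ⊔ ℓ)) → Dec P
excluded-middle {c} {ℓ} {R} pid P = decide (principal J)
  where
  open CommutativeRing R hiding (zero)
  open IsPrincipalIdealDomain pid
  open IsIntegralDomain isIntegralDomain
  open SemiringDivisibility semiring using (∣ʳ-refl; ∣ʳ-respˡ-≈; 0∣x⇒x≈0)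

  J : Ideal R (c ⊔ ℓ)
  J = record
    { Member   = λ x → x ≈ 0# ⊎ P
    ; resp     = λ x≈y → [ (λ x≈0 → inj₁ (trans (sym x≈y) x≈0)) , inj₂ ]′
    ; 0∈       = inj₁ refl
    ; +-closed = λ where
        (inj₁ x≈0) (inj₁ y≈0) → inj₁ (trans (+-cong x≈0 y≈0) (+-identityˡ 0#))
        (inj₁ _)   (inj₂ p)   → inj₂ p
        (inj₂ p)   _          → inj₂ p
    ; *-closed = λ r → [ (λ x≈0 → inj₁ (trans (*-congˡ x≈0) (zeroʳ r))) , inj₂ ]′
    }

  decide : ∃[ d ] Ideal.Member J ≐ Ideal.Member (principalIdeal R d) → Dec P
  -- Since the generator lies in `J`, either `P` holds or `d ≈ 0#`; in the latter case `P` would put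
  -- `1#` into the zero ideal.
  decide (d , J⊆dR , dR⊆J) with dR⊆J ∣ʳ-refl
  ... | inj₂ p   = yes p
  ... | inj₁ d≈0 = no λ p → 1≉0 (0∣x⇒x≈0 (∣ʳ-respˡ-≈ d≈0 (J⊆dR (inj₂ p))))

-- Prime powers and truncated orders in an integral domain.

module PrimePowers {R : CommutativeRing c ℓ} (isDomain : IsIntegralDomain R) where

  open CommutativeRing R hiding (zero)
  open Arithmetic R
  open IsIntegralDomain isDomain
  open CommutativeSemigroupProperties *-commutativeSemigroup using (x∙yz≈y∙xz; interchange)
  open CommutativeSemigroupDivisibility *-commutativeSemigroup using (x∣y⇒zx∣zy; ∙-cong-∣)
  open CommutativeMonoidSum *-commutativeMonoid using () renaming (sum-remove to product-remove)
  open GroupProperties +-group using (x∙y⁻¹≈ε⇒x≈y; x≈y⇒x∙y⁻¹≈ε)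
  open RingProperties ring using (x[y-z]≈xy-xz)
  open SemiringDivisibility semiring
  open SemiringExp semiring using (^-homo-*)

  *-cancelˡ-nonZero : ∀ {x y z} → x ≉ 0# → x * y ≈ x * z → y ≈ z
  *-cancelˡ-nonZero {x} {y} {z} x≉0 xy≈xz =
    [ (λ x≈0 → contradiction x≈0 x≉0) , x∙y⁻¹≈ε⇒x≈y y z ]′
      (noZeroDivisors (trans (x[y-z]≈xy-xz x y z) (x≈y⇒x∙y⁻¹≈ε xy≈xz)))

  *-cancelˡ-∣ : ∀ {x y z} → x ≉ 0# → x * y ∣ x * z → y ∣ z
  *-cancelˡ-∣ x≉0 (q , eq) = q , *-cancelˡ-nonZero x≉0 (trans (x∙yz≈y∙xz _ q _) eq)

  ^-monoʳ-∣ : ∀ x {j k} → j ≤ k → x ^ j ∣ x ^ k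
  ^-monoʳ-∣ x z≤n       = 1∣ _
  ^-monoʳ-∣ x (s≤s j≤k) = x∣y⇒zx∣zy x (^-monoʳ-∣ x j≤k)

  module _ {p} (prime : Prime p) where
    open Prime prime

    ^≉0 : ∀ k → p ^ k ≉ 0#
    ^≉0 zero    = 1≉0
    ^≉0 (suc k) = [ p≉0 , ^≉0 k ]′ ∘ noZeroDivisors

    ∣^⇒∣ : ∀ {x} k → p ∣ x ^ k → p ∣ x
    ∣^⇒∣ zero    p∣1  = contradiction p∣1 p∤1
    ∣^⇒∣ (suc k) p∣xxᵏ = [ id , ∣^⇒∣ k ]′ (split-∣ p∣xxᵏ)

    ∣product⇒∃∣ : ∀ {n} (t : Vector Carrier n) → p ∣ product t → ∃[ i ] p ∣ t i
    ∣product⇒∃∣ {zero}  t p∣1 = contradiction p∣1 p∤1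
    ∣product⇒∃∣ {suc n} t p∣∏ with split-∣ p∣∏
    ... | inj₁ p∣t₀ = zero , p∣t₀
    ... | inj₂ p∣∏′ with i , p∣tᵢ ← ∣product⇒∃∣ (t ∘ suc) p∣∏′ = suc i , p∣tᵢ

    -- A factor `p` of the product must come from `x`; it is cancelled on both sides, and the
    -- induction goes on with the cofactor `x′`.
    ^∣xy∧∤y⇒^∣x : ∀ k {x y} → p ^ k ∣ x * y → p ∤ y → p ^ k ∣ x
    ^∣xy∧∤y⇒^∣x zero    _       _   = 1∣ _
    ^∣xy∧∤y⇒^∣x (suc k) ppᵏ∣xy p∤y
      with split-∣ (∣ʳ-trans (p ^ k , *-comm (p ^ k) p) ppᵏ∣xy)
    ... | inj₂ p∣y           = contradiction p∣y p∤y
    ... | inj₁ (x′ , x′p≈x) = ∣ʳ-respʳ-≈ (trans (*-comm p x′) x′p≈x)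
      (x∣y⇒zx∣zy p (^∣xy∧∤y⇒^∣x k
        (*-cancelˡ-∣ p≉0 (∣ʳ-respʳ-≈
          (trans (*-congʳ (trans (sym x′p≈x) (*-comm x′ p))) (*-assoc p x′ _)) ppᵏ∣xy)) p∤y))

    ∤⇒^suc∤ : ∀ k {x} → p ∤ x → p ^ suc k ∤ p ^ k * x
    ∤⇒^suc∤ k p∤x pᵏ⁺¹∣pᵏx = p∤x (*-cancelˡ-∣ (^≉0 k) (∣ʳ-respˡ-≈ (*-comm p (p ^ k)) pᵏ⁺¹∣pᵏx))

    -- Neither cofactor `a` nor `b` is divisible by `p`, and by primality neither is their product:
    -- exact orders add.
    ^suc∤-* : ∀ k l {x y} → p ^ k ∣ x → p ^ suc k ∤ x → p ^ l ∣ y → p ^ suc l ∤ y →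
              p ^ suc (k ℕ.+ l) ∤ x * y
    ^suc∤-* k l {x} {y} (a , apᵏ≈x) pᵏ⁺¹∤x (b , bpˡ≈y) pˡ⁺¹∤y =
      ∤⇒^suc∤ (k ℕ.+ l) p∤ab ∘ ∣ʳ-respʳ-≈ (begin
        x * y                       ≈⟨ *-cong apᵏ≈x bpˡ≈y ⟨
        (a * p ^ k) * (b * p ^ l)   ≈⟨ interchange a (p ^ k) b (p ^ l) ⟩
        (a * b) * (p ^ k * p ^ l)   ≈⟨ *-comm _ _ ⟩
        (p ^ k * p ^ l) * (a * b)   ≈⟨ *-congʳ (^-homo-* p k l) ⟨
        p ^ (k ℕ.+ l) * (a * b)     ∎)
      where
      open ≈-Reasoning setoid
      p∤ab : p ∤ a * b
      p∤ab = [ (λ p∣a → pᵏ⁺¹∤x (∣ʳ-respʳ-≈ apᵏ≈x (x∣ʳy⇒xz∣ʳyz (p ^ k) p∣a)))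
             , (λ p∣b → pˡ⁺¹∤y (∣ʳ-respʳ-≈ bpˡ≈y (x∣ʳy⇒xz∣ʳyz (p ^ l) p∣b))) ]′ ∘ split-∣

    -- Let `p ≈ a * q`. By primality `p` divides `q`, which makes them associated, or `a`, and then
    -- cancelling `p` makes `q` a unit.
    ¬associated⇒∤ : ∀ {q} → Prime q → ¬ Associated q p → q ∤ p
    ¬associated⇒∤ {q} prime-q q≁p q∣p@(a , aq≈p)
      with split-∣ (∣ʳ-reflexive (sym aq≈p))
    ... | inj₂ p∣q         = q≁p (q∣p , p∣q)
    ... | inj₁ (b , bp≈a) = Prime.p∤1 prime-q (b , *-cancelˡ-nonZero p≉0 (begin
      p * (b * q) ≈⟨ x∙yz≈y∙xz p b q ⟩
      b * (p * q) ≈⟨ *-assoc b p q ⟨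
      (b * p) * q ≈⟨ *-congʳ bp≈a ⟩
      a * q       ≈⟨ aq≈p ⟩
      p           ≈⟨ *-identityʳ p ⟨
      p * 1#      ∎))
      where open ≈-Reasoning setoid

  -- The guard in `maximal` makes the order `m` mean at least `m`, so that `0#` has one too. As a
  -- relation, it lets searched and explicitly known orders be compared by uniqueness.
  record IsTruncatedOrder (p : Carrier) {m : ℕ} (x : Carrier) (k : Fin (suc m)) : Set (c ⊔ ℓ) where
    constructor _,_
    field
      divides : p ^ toℕ k ∣ x
      maximal : toℕ k < m → p ^ suc (toℕ k) ∤ x

  open IsTruncatedOrder

  truncatedOrder-≤ : ∀ {p m x} {k l : Fin (suc m)} →
                     IsTruncatedOrder p x k → IsTruncatedOrder p x l → toℕ k ≤ toℕ l
  truncatedOrder-≤ {p} {k = k} kOrd lOrd = ℕ.≮⇒≥ λ l<k →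
    maximal lOrd (ℕ.<-≤-trans l<k (Fin.toℕ≤pred[n] k)) (∣ʳ-trans (^-monoʳ-∣ p l<k) (divides kOrd))

  truncatedOrder-unique : ∀ {p m x} {k l : Fin (suc m)} →
                          IsTruncatedOrder p x k → IsTruncatedOrder p x l → k ≡ l
  truncatedOrder-unique kOrd lOrd =
    Fin.toℕ-injective (ℕ.≤-antisym (truncatedOrder-≤ kOrd lOrd) (truncatedOrder-≤ lOrd kOrd))

  -- If the orders add up to less than `m`, both lie below the cap and are exact, so their sum is
  -- the exact order of the product.
  ^∣*⇔≤+ : ∀ {p m x y} {k l : Fin (suc m)} → Prime p →
           IsTruncatedOrder p x k → IsTruncatedOrder p y l →
           p ^ m ∣ x * y ⇔ m ≤ toℕ k ℕ.+ toℕ l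
  ^∣*⇔≤+ {p} {m} {x} {y} {k} {l} prime (pᵏ∣x , pᵏ⁺¹∤x) (pˡ∣y , pˡ⁺¹∤y) = mk⇔
    (λ pᵐ∣xy → ℕ.≮⇒≥ λ k+l<m →
      ^suc∤-* prime (toℕ k) (toℕ l)
        pᵏ∣x (pᵏ⁺¹∤x (ℕ.≤-<-trans (ℕ.m≤m+n (toℕ k) (toℕ l)) k+l<m))
        pˡ∣y (pˡ⁺¹∤y (ℕ.≤-<-trans (ℕ.m≤n+m (toℕ l) (toℕ k)) k+l<m))
        (∣ʳ-trans (^-monoʳ-∣ p k+l<m) pᵐ∣xy))
    (λ m≤k+l → ∣ʳ-trans (^-monoʳ-∣ p m≤k+l)
      (∣ʳ-respˡ-≈ (sym (^-homo-* p (toℕ k) (toℕ l))) (∙-cong-∣ pᵏ∣x pˡ∣y)))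

  factor∣product : ∀ {n} (t : Vector Carrier n) i → t i ∣ product t
  factor∣product t zero    = _ , *-comm _ _
  factor∣product t (suc i) = x∣ʳy⇒x∣ʳzy (t zero) (factor∣product (t ∘ suc) i)

  -- The tail product divides `x` with quotient `q`. The first prime divides none of the later ones,
  -- so its power must divide `q`.
  product-^∣ : ∀ {n} (p : Vector Carrier n) (m : Vector ℕ n) {x} →
               (∀ i → Prime (p i)) → (∀ i j → i ≢ j → p i ∤ p j) →
               (∀ i → p i ^ m i ∣ x) → product (λ i → p i ^ m i) ∣ x
  product-^∣ {zero}  p m prime distinct pᵐ∣x = 1∣ _
  product-^∣ {suc n} p m prime distinct pᵐ∣x
    with q , eq ← product-^∣ (p ∘ suc) (m ∘ suc) (prime ∘ suc)
                    (λ i j i≢j → distinct (suc i) (suc j) (i≢j ∘ Fin.suc-injective)) (pᵐ∣x ∘ suc)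
    = ∣ʳ-respʳ-≈ eq (x∣ʳy⇒xz∣ʳyz _ (^∣xy∧∤y⇒^∣x (prime zero) (m zero)
        (∣ʳ-respʳ-≈ (sym eq) (pᵐ∣x zero))
        λ p₀∣∏ → let j , p₀∣ = ∣product⇒∃∣ (prime zero) _ p₀∣∏ in
          distinct zero (suc j) (λ ()) (∣^⇒∣ (prime zero) (m (suc j)) p₀∣)))

  -- Pulling out factor `i` leaves a product not divisible by `p i`. Such products realise every box
  -- point as a vector of orders.
  product-truncatedOrder : ∀ {n} (p : Vector Carrier n) {m : Vector ℕ n} (w : Box m) →
    (∀ i → Prime (p i)) → (∀ i j → i ≢ j → p i ∤ p j) →
    ∀ i → IsTruncatedOrder (p i) (product (λ j → p j ^ toℕ (w j))) (w i)
  product-truncatedOrder {suc n} p w prime distinct i =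
      factor∣product t i
    , λ _ → ∤⇒^suc∤ (prime i) (toℕ (w i))
        (λ pᵢ∣∏ → let j , pᵢ∣ = ∣product⇒∃∣ (prime i) _ pᵢ∣∏ in
          distinct i (punchIn i j) (Fin.punchInᵢ≢i i j ∘ ≡.sym)
            (∣^⇒∣ (prime i) (toℕ (w (punchIn i j))) pᵢ∣))
        ∘ ∣ʳ-respʳ-≈ (product-remove {i = i} t)
    where
    t : Vector Carrier (suc n)
    t j = p j ^ toℕ (w j)

-- The exponent vector on the quotient ring.

corollary73 : ∀ {c ℓ : Level} (R : CommutativeRing c ℓ) →
    let open CommutativeRing R
        open Arithmetic R in
    IsPrincipalIdealDomain R →
    (g : Carrier) →
    let I = principalIdeal R g
        Q = R / I in
    IsProper I →
    ¬ IsPrimeIdeal I →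
    Finite (CommutativeRing.setoid Q) →
    (n : ℕ) (u : Carrier) (p : Vector Carrier n) (m : Vector ℕ n) →
    Unit u →
    ((i : Fin n) → Prime (p i)) →
    ((i j : Fin n) → i ≢ j → ¬ Associated (p i) (p j)) →
    ((i : Fin n) → 1 ≤ m i) →
    g ≈ u * product (λ i → p i ^ m i) →
    3 ≤ n →
    ΓE′ Q ≅ D m
corollary73 {c} {ℓ} R pid g _ _ _ n u p m u∣1 prime p≁p m≥1 g≈u∏ n≥3 =
  ZeroDivisorGraph.ΓE′≅D (R / principalIdeal R g) m≥1 n≥3 v v-surjective zero-product
  where
  open CommutativeRing R hiding (zero)
  open Arithmetic R
  open BoxPoints m using (_≋_; Covers)
  open PrimePowers (IsPrincipalIdealDomain.isIntegralDomain pid)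
  open RingProperties ring using (-0#≈0#)
  open SemiringDivisibility semiring
  module Q = CommutativeRing (R / principalIdeal R g)

  ∏ : Carrier
  ∏ = product (λ i → p i ^ m i)

  distinct : ∀ i j → i ≢ j → p i ∤ p j
  distinct i j i≢j = ¬associated⇒∤ (prime j) (prime i) (p≁p i j i≢j)

  g∣∏ : g ∣ ∏
  g∣∏ = ∣ʳ-respʳ-≈ (*-identityˡ ∏) (∣ʳ-respˡ-≈ (sym g≈u∏) (x∣ʳy⇒xz∣ʳyz ∏ u∣1))

  order : ∀ x i → ∃[ k ] IsTruncatedOrder (p i) {m i} x k
  order x i with k , pᵏ∣x , max ←
      greatest (λ k → excluded-middle pid (p i ^ k ∣ x)) (1∣ x) (m i) = k , (pᵏ∣x , max)

  v : Carrier → Box m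
  v x i = proj₁ (order x i)

  v-surjective : ∀ w → ∃[ x ] v x ≋ w
  -- The hidden witness is the product of the powers `p j ^ toℕ (w j)`, found by unification with
  -- `product-truncatedOrder`.
  v-surjective w = _ , λ i →
    truncatedOrder-unique (proj₂ (order _ i)) (product-truncatedOrder p w prime distinct i)

  x-0≈x : ∀ x → x - 0# ≈ x
  x-0≈x x = trans (+-congˡ -0#≈0#) (+-identityʳ x)

  zero-product : ∀ x y → x * y Q.≈ 0# ⇔ Covers (v x) (v y)
  zero-product x y = mk⇔
    -- Each prime power divides `∏`, hence `g`, hence `x * y`. Conversely, `g` divides `∏`, which
    -- divides whatever all the prime powers divide.
    (λ g∣xy-0 i → Equivalence.to (^∣*⇔≤+ (prime i) (proj₂ (order x i)) (proj₂ (order y i)))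
      (∣ʳ-trans (factor∣product _ i)
        (∣ʳ-trans (u , sym g≈u∏) (∣ʳ-respʳ-≈ (x-0≈x (x * y)) g∣xy-0))))
    (λ cov → ∣ʳ-respʳ-≈ (sym (x-0≈x (x * y))) (∣ʳ-trans g∣∏ (product-^∣ p m prime distinct λ i →
      Equivalence.from (^∣*⇔≤+ (prime i) (proj₂ (order x i)) (proj₂ (order y i))) (cov i))))
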